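{- The family $\mathbb{F}(5,3)$ is a CIF$(5,3)$ with exactly $6$ blocks and exactly $76$ transversals. Consequently $\mathrm{M}(5)\ge 234$.
   Context: A family is a non-empty set of non-empty finite sets, called its blocks. A family is uniform if all its blocks have the same size, denoted $\mathrm{k}(\mathcal{G})$. A blocking set of $\mathcal{G}$ is a set meeting every block of $\mathcal{G}$. If $\mathcal{G}$ has a finite blocking set, $\mathrm{tr}(\mathcal{G})$ is the smallest size of a blocking set, a transversal is a blocking set of size $\mathrm{tr}(\mathcal{G})$, and $\mathcal{G}^{\top}$ is the family of all transversals of $\mathcal{G}$; otherwise $\mathrm{tr}(\mathcal{G})=\infty$. The symbol $\sqcup$ denotes disjoint union. A MIF$(k)$ is a uniform family $\mathcal{F}$ with $\mathrm{k}(\mathcal{F})=k$, $\mathrm{tr}(\mathcal{F})<\infty$ and $\mathcal{F}=\mathcal{F}^{\top}$. $\mathrm{M}(k)$ denotes the maximum number of blocks in a MIF$(k)$ (finite, since by Erdős–Lovász a MIF$(k)$ has at most $k^k$ blocks). A CIF$(k,t)$ is a uniform family $\mathcal{F}$ with $\mathrm{k}(\mathcal{F})=k$, $\mathrm{tr}(\mathcal{F})=t\le k-1$ and $\mathcal{F}=(\mathcal{F}\sqcup\mathcal{F}^{\top})^{\top}$. Definition of $\mathbb{F}(k,t)$, for positive integers $t\le k$: let $X_0,\dots,X_{t-1}$ be pairwise disjoint sets with $|X_n|=k-\lfloor t/2\rfloor$ if $0\le n\le\lfloor (t-1)/2\rfloor$ and $|X_n|=k-\lfloor (t-1)/2\rfloor$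 if $\lfloor (t-1)/2\rfloor+1\le n\le t-1$; write $X_n=\{x^n_p:0\le p\le|X_n|-1\}$. Then $\mathbb{F}(k,t)$ is the family of all $k$-sets of the form $X_n\sqcup\{x^{n+i}_{p_i}:1\le i\le k-|X_n|\}$, where $0\le n\le t-1$, superscripts are taken modulo $t$, and $(p_i)_{i\ge0}$ is any integer sequence with $p_0=0$ and $p_{i-1}\le p_i\le p_{i-1}+1$ for $i\ge1$. In particular, for $k=5,t=3$, all three $X_n$ have size $4$ and the blocks are $X_n\sqcup\{x^{n+1}_{p}\}$ with $n\in\{0,1,2\}$, $p\in\{0,1\}$. -}

module Defs where

open import Level using (Level; 0ℓ)
open import Data.Bool.Base using (if_then_else_)
open import Data.Fin.Base using (Fin; toℕ)
open import Data.List.Base using (List; length)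
open import Data.List.Membership.Propositional using () renaming (_∈_ to _∈ˡ_)
import Data.List.Membership.Setoid as SetoidMembership
open import Data.List.Relation.Unary.Unique.Propositional using (Unique)
import Data.List.Relation.Unary.Unique.Setoid as SetoidUnique
open import Data.Nat.Base
  using (ℕ; suc; _+_; _∸_; _≤_; _≤ᵇ_; _%_; ⌊_/2⌋; NonZero)
open import Data.Product.Base using (Σ-syntax; ∃-syntax; _×_; _,_)
open import Function.Bundles using (_⇔_)
open import Relation.Binary.Bundles using (Setoid)
import Relation.Binary.Construct.On as On
open import Relation.Binary.Definitions using (_Respects_)
open import Relation.Binary.PropositionalEquality.Core using (_≡_)
open import Relation.Unary using (Pred; _∈_; _≐_; _≬_; _⊥_; _∪_)
open import Relation.Unary.Relation.Binary.Equality using (≐-setoid)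

private
  variable
    ℓ : Level
    A : Set

-- A finite set is a list without repetitions; two such lists are the same set
-- when they have the same elements (see _≈_), irrespective of their order.

record FinSet (A : Set) : Set where
  constructor finSet
  field
    elements : List A
    unique   : Unique elements

⟦_⟧ : FinSet A → Pred A 0ℓ
⟦ B ⟧ x = x ∈ˡ FinSet.elements B

size : FinSet A → ℕ
size B = length (FinSet.elements B)

infix 4 _≈_

_≈_ : FinSet A → FinSet A → Set
B ≈ C = ⟦ B ⟧ ≐ ⟦ C ⟧

finSetSetoid : Set → Setoid 0ℓ 0ℓ
finSetSetoid A = On.setoid {B = FinSet A} (≐-setoid A 0ℓ) ⟦_⟧

-- A Collection may depend on the order of elements; IsFamily requires it to respect
-- equality of finite sets.

Collection : Set → Set₁
Collection A = Pred (FinSet A) 0ℓ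

record IsFamily (𝓖 : Collection A) : Set where
  field
    respects       : 𝓖 Respects _≈_
    nonempty       : ∃[ B ] B ∈ 𝓖
    blocksNonempty : ∀ B → B ∈ 𝓖 → ∃[ x ] x ∈ ⟦ B ⟧

-- The collection has exactly n members, counted up to equality of sets.

HasCardinality : Collection A → ℕ → Set
HasCardinality {A} 𝓖 n =
  Σ[ Bs ∈ List (FinSet A) ]
    SetoidUnique.Unique (finSetSetoid A) Bs
    × length Bs ≡ n
    × (∀ B → B ∈ 𝓖 ⇔ SetoidMembership._∈_ (finSetSetoid A) B Bs)

IsUniform : Collection A → ℕ → Set
IsUniform 𝓖 k = ∀ B → B ∈ 𝓖 → size B ≡ k

IsBlockingSet : Collection A → Pred A ℓ → Set ℓ
IsBlockingSet 𝓖 S = ∀ B → B ∈ 𝓖 → ⟦ B ⟧ ≬ S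

HasFiniteTr : Collection A → Set
HasFiniteTr 𝓖 = ∃[ S ] IsBlockingSet 𝓖 ⟦ S ⟧

-- tr(𝓖) = t, with t finite.  Infinite blocking sets play no role in the minimum.

record IsTr (𝓖 : Collection A) (t : ℕ) : Set where
  field
    attained : ∃[ S ] IsBlockingSet 𝓖 ⟦ S ⟧ × size S ≡ t
    minimal  : ∀ S → IsBlockingSet 𝓖 ⟦ S ⟧ → t ≤ size S

infix 10 _^⊤

_^⊤ : Collection A → Collection A
(𝓖 ^⊤) T = IsBlockingSet 𝓖 ⟦ T ⟧ × IsTr 𝓖 (size T)

record IsMIF (k : ℕ) (𝓕 : Collection A) : Set where
  field
    isFamily : IsFamily 𝓕
    uniform  : IsUniform 𝓕 k
    finiteTr : HasFiniteTr 𝓕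
    closed   : 𝓕 ≐ 𝓕 ^⊤

-- closed is 𝓕 = (𝓕 ⊔ 𝓕^⊤)^⊤, with disjoint stating that ⊔ is a disjoint union.

record IsCIF (k t : ℕ) (𝓕 : Collection A) : Set where
  field
    isFamily : IsFamily 𝓕
    uniform  : IsUniform 𝓕 k
    tr       : IsTr 𝓕 t
    t≤k-1    : t ≤ k ∸ 1
    disjoint : 𝓕 ⊥ 𝓕 ^⊤
    closed   : 𝓕 ≐ (𝓕 ∪ 𝓕 ^⊤) ^⊤

-- M(k) = m: the maximum is over families on arbitrary sets of points.

record IsM (k m : ℕ) : Set₁ where
  field
    attained : Σ[ A ∈ Set ] Σ[ 𝓕 ∈ Collection A ] IsMIF k 𝓕 × HasCardinality 𝓕 m
    maximal  : ∀ (A : Set) (𝓕 : Collection A) n →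
               IsMIF k 𝓕 → HasCardinality 𝓕 n → n ≤ m

-- Everything below is meant for 1 ≤ t ≤ k, where the subtractions do not truncate.

∣X∣ : (k t n : ℕ) → ℕ
∣X∣ k t n = if n ≤ᵇ ⌊ t ∸ 1 /2⌋ then k ∸ ⌊ t /2⌋ else k ∸ ⌊ t ∸ 1 /2⌋

-- The disjoint union of X₀, …, X_{t-1}; the pair (n , p) is the point xⁿₚ.

Point : (k t : ℕ) → Set
Point k t = Σ[ n ∈ Fin t ] Fin (∣X∣ k t (toℕ n))

X : ∀ {k t} → Fin t → Pred (Point k t) 0ℓ
X n (m , _) = m ≡ n

-- The points xⁿ⁺ⁱ_{pᵢ} with 1 ≤ i ≤ k - |Xₙ|.

Path : ∀ {k t} .{{_ : NonZero t}} → Fin t → (ℕ → ℕ) → Pred (Point k t) 0ℓ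
Path {k} {t} n p (m , q) =
  ∃[ i ] 1 ≤ i × i ≤ k ∸ ∣X∣ k t (toℕ n)
       × toℕ m ≡ (toℕ n + i) % t × toℕ q ≡ p i

-- Integer sequences with p₀ = 0 and pᵢ₋₁ ≤ pᵢ ≤ pᵢ₋₁ + 1 are nonnegative,
-- so they are taken with values in ℕ.

IsAdmissible : (ℕ → ℕ) → Set
IsAdmissible p = p 0 ≡ 0 × (∀ i → p i ≤ p (suc i) × p (suc i) ≤ p i + 1)

-- X n and Path n p are disjoint when 1 ≤ t ≤ k, since then
-- k - |Xₙ| ≤ ⌊t/2⌋ < t and so n + i ≢ n modulo t.

𝔽 : (k t : ℕ) .{{_ : NonZero t}} → Collection (Point k t)
𝔽 k t B =
  size B ≡ k
  × Σ[ n ∈ Fin t ] Σ[ p ∈ (ℕ → ℕ) ]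
      IsAdmissible p × ⟦ B ⟧ ≐ X n ∪ Path n p

{-# OPTIONS --safe #-}
module Submission where

-- A blocking set of 𝔽(5,3) either meets all three Xₙ, or misses some Xₙ and then contains
-- xⁿ⁺¹₀, xⁿ⁺¹₁ and a point of Xₙ₊₂.  So it contains one of 4³ + 3·4 = 76 explicit 3-sets,
-- and these are the transversals.  A set meeting all of them contains some Xₙ (otherwise
-- choose one missing point in each Xₙ), and then a block.
--
-- If 𝓕 is a CIF(k,t) and 𝓖 a MIF(k-t) on new points, then the blocks of 𝓕 together with
-- all disjoint unions of a transversal of 𝓕 and a block of 𝓖 form a MIF(k).  For
-- 𝓕 = 𝔽(5,3) and 𝓖 the triangle this has 6 + 76·3 = 234 blocks.

open import Level using (0ℓ)
open import Data.Fin.Base using (Fin; zero; suc; toℕ; fromℕ<; cast; _↑ˡ_)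
open import Data.Fin.Patterns using (0F; 1F; 2F)
import Data.Fin.Properties as Fin
open import Data.List.Base
  using (List; []; _∷_; _++_; map; mapMaybe; length; lookup; allFin;
         cartesianProduct; cartesianProductWith)
open import Data.List.Membership.Propositional using (find) renaming (_∈_ to _∈ˡ_)
open import Data.List.Membership.Propositional.Properties
  using (∈-lookup; ∈-++⁺ˡ; ∈-++⁺ʳ; ∈-++⁻; ∈-map⁺; ∈-map⁻; ∈-allFin; ∈-cartesianProduct⁺;
         ∈-cartesianProductWith⁺; ∈-cartesianProductWith⁻)
import Data.List.Membership.DecPropositional as DecMembership
import Data.List.Membership.Setoid as SetoidMembership
import Data.List.Membership.Setoid.Properties as SetoidMembershipₚ
open import Data.List.Properties using (length-++; length-map)
open import Data.List.Relation.Unary.All as All using (All; []; _∷_)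
open import Data.List.Relation.Unary.All.Properties using (¬Any⇒All¬)
open import Data.List.Relation.Unary.AllPairs using ([]; _∷_; allPairs?)
open import Data.List.Relation.Unary.Any as Any using (here; there; index)
open import Data.List.Relation.Unary.Any.Properties using (lookup-index)
open import Data.List.Relation.Unary.Unique.Propositional using (Unique)
import Data.List.Relation.Unary.Unique.Propositional.Properties as Unique
open import Data.List.Relation.Unary.Unique.Setoid using () renaming (Unique to SetoidUnique)
import Data.List.Relation.Unary.Unique.Setoid.Properties as SetoidUnique
open import Data.Maybe.Base using (Maybe; just; nothing)
open import Data.Nat.Base
  using (ℕ; zero; suc; _+_; _*_; _∸_; _%_; _≤_; _<_; z≤n; s≤s; s≤s⁻¹)
open import Data.Nat.Properties as ℕ
  using (≤-refl; ≤-reflexive; ≤-trans; ≤-antisym; ≤⇒≯; +-mono-≤; +-monoˡ-≤; +-monoʳ-≤;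
         +-cancelˡ-≡; +-cancelˡ-≤; +-cancelʳ-≤; +-identityʳ; m≤m+n)
open import Data.Product.Base using (Σ-syntax; ∃-syntax; _×_; _,_; proj₁; proj₂)
open import Data.Product.Properties using (≡-dec)
open import Data.Sum using (_⊎_; inj₁; inj₂; isInj₁; isInj₂; [_,_]′)
open import Data.Sum.Properties using (inj₁-injective; inj₂-injective)
open import Function.Base using (case_of_)
open import Function.Bundles using (mk⇔; Equivalence)
open import Relation.Binary.Bundles using (Setoid)
open import Relation.Binary.Definitions using (DecidableEquality; _Respects_)
open import Relation.Binary.PropositionalEquality
  using (_≡_; _≢_; refl; sym; trans; cong; cong₂; subst; subst₂; setoid; module ≡-Reasoning)
open import Relation.Nullary using (Dec; yes; no; ¬_; ¬?; contradiction; _×-dec_; _⊎-dec_)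
open import Relation.Nullary.Decidable using (decidable-stable; from-yes; map′)
open import Relation.Unary using (Pred; _∈_; _⊆_; _≐_; _≬_; _∪_)
open import Relation.Unary.Properties using (≐-sym; ≐-trans; ≬-sym)
open import Defs

private
  variable
    A B : Set

-- Finite sets

lookup-injective : ∀ {xs : List A} → Unique xs → ∀ i j → lookup xs i ≡ lookup xs j → i ≡ j
lookup-injective (x∉xs ∷ _)  zero    zero    _  = refl
lookup-injective (x∉xs ∷ _)  zero    (suc j) eq = contradiction eq (All.lookup x∉xs (∈-lookup j))
lookup-injective (x∉xs ∷ _)  (suc i) zero    eq =
  contradiction (sym eq) (All.lookup x∉xs (∈-lookup i))
lookup-injective (_ ∷ xs!)   (suc i) (suc j) eq = cong suc (lookup-injective xs! i j eq)

-- Sending each index of `xs` to the position of its entry in `ys` is injective, so the pigeonhole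
-- principle on `Fin` applies.
Unique-⊆⇒length-≤ : ∀ {xs ys : List A} → Unique xs → (_∈ˡ xs) ⊆ (_∈ˡ ys) → length xs ≤ length ys
Unique-⊆⇒length-≤ {xs = xs} {ys} xs! xs⊆ys =
  Fin.injective⇒≤ {f = position} λ {i} {j} eq →
    lookup-injective xs! i j
      (trans (lookup-index (at i)) (trans (cong (lookup ys) eq) (sym (lookup-index (at j)))))
  where
  at : ∀ i → lookup xs i ∈ˡ ys
  at i = xs⊆ys (∈-lookup i)
  position : Fin (length xs) → Fin (length ys)
  position i = index (at i)

size-mono : (S T : FinSet A) → ⟦ S ⟧ ⊆ ⟦ T ⟧ → size S ≤ size T
size-mono S _ = Unique-⊆⇒length-≤ (FinSet.unique S)

size-cong : (S T : FinSet A) → S ≈ T → size S ≡ size T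
size-cong S T (S⊆T , T⊆S) = ≤-antisym (size-mono S T S⊆T) (size-mono T S T⊆S)

-- The sets are explicit arguments because a pair of inclusions does not determine the uniqueness
-- proofs stored in them.
≈-refl : (S : FinSet A) → S ≈ S
≈-refl S = Setoid.refl (finSetSetoid _) {S}

≈-sym : (S T : FinSet A) → S ≈ T → T ≈ S
≈-sym S T = Setoid.sym (finSetSetoid _) {S} {T}

≈-trans : (S T U : FinSet A) → S ≈ T → T ≈ U → S ≈ U
≈-trans S T U = Setoid.trans (finSetSetoid _) {S} {T} {U}

∅ : FinSet A
∅ = finSet [] []

size-0⇒≈∅ : (S : FinSet A) → size S ≡ 0 → S ≈ ∅
size-0⇒≈∅ (finSet [] _) _ = (λ ()) , (λ ())

∈? : DecidableEquality A → (S : FinSet A) → ∀ x → Dec (x ∈ ⟦ S ⟧)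
∈? _≟_ S x = DecMembership._∈?_ _≟_ x (FinSet.elements S)

-- A point of `T` missing from `S` could be added to `S`, giving a subset of `T` with more elements
-- than `T` has.
⊆∧size-≤⇒⊇ : DecidableEquality A → (S T : FinSet A) → ⟦ S ⟧ ⊆ ⟦ T ⟧ → size T ≤ size S → ⟦ T ⟧ ⊆ ⟦ S ⟧
⊆∧size-≤⇒⊇ _≟_ S T S⊆T ∣T∣≤∣S∣ {x} x∈T = decidable-stable (∈? _≟_ S x) λ x∉S →
  ≤⇒≯ ∣T∣≤∣S∣ (size-mono (finSet (x ∷ FinSet.elements S) (¬Any⇒All¬ _ x∉S ∷ FinSet.unique S)) T
    λ { (here refl) → x∈T ; (there y∈S) → S⊆T y∈S })

≬-mono : {P P′ Q Q′ : Pred A 0ℓ} → P ⊆ P′ → Q ⊆ Q′ → P ≬ Q → P′ ≬ Q′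
≬-mono P⊆P′ Q⊆Q′ (x , x∈P , x∈Q) = x , P⊆P′ x∈P , Q⊆Q′ x∈Q

≬? : DecidableEquality A → (S T : FinSet A) → Dec (⟦ S ⟧ ≬ ⟦ T ⟧)
≬? _≟_ S T with Any.any? (∈? _≟_ T) (FinSet.elements S)
... | yes any = yes (find any)
... | no ¬any = no λ (x , x∈S , x∈T) → ¬any (Any.map (λ { refl → x∈T }) x∈S)

-- Finite sets in a disjoint union

∈-mapMaybe⁻ : (f : A → Maybe B) (xs : List A) {y : B} →
              y ∈ˡ mapMaybe f xs → ∃[ x ] x ∈ˡ xs × f x ≡ just y
∈-mapMaybe⁻ f (x ∷ xs) y∈ with f x in eq | y∈
... | nothing | y∈ys       = let x , x∈ , fx≡ = ∈-mapMaybe⁻ f xs y∈ys in x , there x∈ , fx≡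
... | just _  | here refl  = x , here refl , eq
... | just _  | there y∈ys = let x , x∈ , fx≡ = ∈-mapMaybe⁻ f xs y∈ys in x , there x∈ , fx≡

∈-mapMaybe⁺ : (f : A → Maybe B) {xs : List A} {x : A} {y : B} →
              x ∈ˡ xs → f x ≡ just y → y ∈ˡ mapMaybe f xs
∈-mapMaybe⁺ f (here {x} refl) fx≡ with f x | fx≡
... | just _ | refl = here refl
∈-mapMaybe⁺ f (there {x} x∈) fx≡ with f x
... | nothing = ∈-mapMaybe⁺ f x∈ fx≡
... | just _  = there (∈-mapMaybe⁺ f x∈ fx≡)

mapMaybe-Unique : (f : A → Maybe B) → (∀ x x′ {y} → f x ≡ just y → f x′ ≡ just y → x ≡ x′) →
                  ∀ {xs} → Unique xs → Unique (mapMaybe f xs)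
mapMaybe-Unique f inj [] = []
mapMaybe-Unique f inj {x ∷ xs} (x∉xs ∷ xs!) with f x in eq
... | nothing = mapMaybe-Unique f inj xs!
... | just y  = ¬Any⇒All¬ _ y∉ ∷ mapMaybe-Unique f inj xs!
  where
  y∉ : ¬ (y ∈ˡ mapMaybe f xs)
  y∉ y∈ = let x′ , x′∈ , fx′≡ = ∈-mapMaybe⁻ f xs y∈ in All.lookup x∉xs x′∈ (inj x x′ eq fx′≡)

infixr 5 _⊎ˢ_

_⊎ˢ_ : FinSet A → FinSet B → FinSet (A ⊎ B)
finSet xs xs! ⊎ˢ finSet ys ys! = finSet (map inj₁ xs ++ map inj₂ ys)
  (Unique.++⁺ (Unique.map⁺ inj₁-injective xs!) (Unique.map⁺ inj₂-injective ys!)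
    λ (∈₁ , ∈₂) → case (∈-map⁻ inj₁ ∈₁ , ∈-map⁻ inj₂ ∈₂) of λ { ((_ , _ , refl) , (_ , _ , ())) })

lefts : FinSet (A ⊎ B) → FinSet A
lefts (finSet xs xs!) = finSet (mapMaybe isInj₁ xs)
  (mapMaybe-Unique isInj₁ (λ { (inj₁ _) (inj₁ _) refl refl → refl }) xs!)

rights : FinSet (A ⊎ B) → FinSet B
rights (finSet xs xs!) = finSet (mapMaybe isInj₂ xs)
  (mapMaybe-Unique isInj₂ (λ { (inj₂ _) (inj₂ _) refl refl → refl }) xs!)

module _ (S : FinSet (A ⊎ B)) where

  ∈-lefts⁺ : ∀ {a} → inj₁ a ∈ ⟦ S ⟧ → a ∈ ⟦ lefts S ⟧
  ∈-lefts⁺ a∈S = ∈-mapMaybe⁺ isInj₁ a∈S refl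

  ∈-lefts⁻ : ∀ {a} → a ∈ ⟦ lefts S ⟧ → inj₁ a ∈ ⟦ S ⟧
  ∈-lefts⁻ a∈ with ∈-mapMaybe⁻ isInj₁ (FinSet.elements S) a∈
  ... | inj₁ _ , a∈S , refl = a∈S

  ∈-rights⁺ : ∀ {b} → inj₂ b ∈ ⟦ S ⟧ → b ∈ ⟦ rights S ⟧
  ∈-rights⁺ b∈S = ∈-mapMaybe⁺ isInj₂ b∈S refl

  ∈-rights⁻ : ∀ {b} → b ∈ ⟦ rights S ⟧ → inj₂ b ∈ ⟦ S ⟧
  ∈-rights⁻ b∈ with ∈-mapMaybe⁻ isInj₂ (FinSet.elements S) b∈
  ... | inj₂ _ , b∈S , refl = b∈S

module _ (S : FinSet A) (T : FinSet B) where

  ∈-⊎ˢ⁺ˡ : ∀ {a} → a ∈ ⟦ S ⟧ → inj₁ a ∈ ⟦ S ⊎ˢ T ⟧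
  ∈-⊎ˢ⁺ˡ a∈S = ∈-++⁺ˡ (∈-map⁺ inj₁ a∈S)

  ∈-⊎ˢ⁺ʳ : ∀ {b} → b ∈ ⟦ T ⟧ → inj₂ b ∈ ⟦ S ⊎ˢ T ⟧
  ∈-⊎ˢ⁺ʳ b∈T = ∈-++⁺ʳ (map inj₁ (FinSet.elements S)) (∈-map⁺ inj₂ b∈T)

  ∈-⊎ˢ⁻ : ∀ {x} → x ∈ ⟦ S ⊎ˢ T ⟧ → [ ⟦ S ⟧ , ⟦ T ⟧ ]′ x
  ∈-⊎ˢ⁻ x∈ with ∈-++⁻ (map inj₁ (FinSet.elements S)) x∈
  ... | inj₁ x∈₁ with ∈-map⁻ inj₁ x∈₁
  ...   | _ , a∈S , refl = a∈S
  ∈-⊎ˢ⁻ x∈ | inj₂ x∈₂ with ∈-map⁻ inj₂ x∈₂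
  ...   | _ , b∈T , refl = b∈T

  size-⊎ˢ : size (S ⊎ˢ T) ≡ size S + size T
  size-⊎ˢ = trans (length-++ (map inj₁ (FinSet.elements S)))
    (cong₂ _+_ (length-map inj₁ (FinSet.elements S)) (length-map inj₂ (FinSet.elements T)))

module _ (S S′ : FinSet A) (T T′ : FinSet B) where

  ⊎ˢ-mono : ⟦ S ⟧ ⊆ ⟦ S′ ⟧ → ⟦ T ⟧ ⊆ ⟦ T′ ⟧ → ⟦ S ⊎ˢ T ⟧ ⊆ ⟦ S′ ⊎ˢ T′ ⟧
  ⊎ˢ-mono S⊆S′ T⊆T′ {inj₁ _} a∈ = ∈-⊎ˢ⁺ˡ S′ T′ (S⊆S′ (∈-⊎ˢ⁻ S T a∈))
  ⊎ˢ-mono S⊆S′ T⊆T′ {inj₂ _} b∈ = ∈-⊎ˢ⁺ʳ S′ T′ (T⊆T′ (∈-⊎ˢ⁻ S T b∈))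

  ≬-⊎ˢ⁺ˡ : ⟦ S ⟧ ≬ ⟦ S′ ⟧ → ⟦ S ⊎ˢ T ⟧ ≬ ⟦ S′ ⊎ˢ T′ ⟧
  ≬-⊎ˢ⁺ˡ (a , a∈S , a∈S′) = inj₁ a , ∈-⊎ˢ⁺ˡ S T a∈S , ∈-⊎ˢ⁺ˡ S′ T′ a∈S′

  ≬-⊎ˢ⁺ʳ : ⟦ T ⟧ ≬ ⟦ T′ ⟧ → ⟦ S ⊎ˢ T ⟧ ≬ ⟦ S′ ⊎ˢ T′ ⟧
  ≬-⊎ˢ⁺ʳ (b , b∈T , b∈T′) = inj₂ b , ∈-⊎ˢ⁺ʳ S T b∈T , ∈-⊎ˢ⁺ʳ S′ T′ b∈T′

  ⊎ˢ-injective-⊆ : ⟦ S ⊎ˢ T ⟧ ⊆ ⟦ S′ ⊎ˢ T′ ⟧ → ⟦ S ⟧ ⊆ ⟦ S′ ⟧ × ⟦ T ⟧ ⊆ ⟦ T′ ⟧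
  ⊎ˢ-injective-⊆ sub =
    (λ a∈S → ∈-⊎ˢ⁻ S′ T′ (sub (∈-⊎ˢ⁺ˡ S T a∈S))) , (λ b∈T → ∈-⊎ˢ⁻ S′ T′ (sub (∈-⊎ˢ⁺ʳ S T b∈T)))

⊎ˢ-cong : (S S′ : FinSet A) (T T′ : FinSet B) → S ≈ S′ → T ≈ T′ → S ⊎ˢ T ≈ S′ ⊎ˢ T′
⊎ˢ-cong S S′ T T′ S≈S′ T≈T′ =
  ⊎ˢ-mono S S′ T T′ (proj₁ S≈S′) (proj₁ T≈T′) , ⊎ˢ-mono S′ S T′ T (proj₂ S≈S′) (proj₂ T≈T′)

⊎ˢ-injective : (S S′ : FinSet A) (T T′ : FinSet B) → S ⊎ˢ T ≈ S′ ⊎ˢ T′ → S ≈ S′ × T ≈ T′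
⊎ˢ-injective S S′ T T′ (⊆₁ , ⊆₂) =
  let S⊆ , T⊆ = ⊎ˢ-injective-⊆ S S′ T T′ ⊆₁ ; S⊇ , T⊇ = ⊎ˢ-injective-⊆ S′ S T′ T ⊆₂
  in (S⊆ , S⊇) , (T⊆ , T⊇)

≈-lefts⊎ˢrights : (S : FinSet (A ⊎ B)) → S ≈ lefts S ⊎ˢ rights S
≈-lefts⊎ˢrights S = to , from
  where
  to : ⟦ S ⟧ ⊆ ⟦ lefts S ⊎ˢ rights S ⟧
  to {inj₁ _} a∈S = ∈-⊎ˢ⁺ˡ (lefts S) (rights S) (∈-lefts⁺ S a∈S)
  to {inj₂ _} b∈S = ∈-⊎ˢ⁺ʳ (lefts S) (rights S) (∈-rights⁺ S b∈S)
  from : ⟦ lefts S ⊎ˢ rights S ⟧ ⊆ ⟦ S ⟧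
  from {inj₁ _} a∈ = ∈-lefts⁻ S (∈-⊎ˢ⁻ (lefts S) (rights S) a∈)
  from {inj₂ _} b∈ = ∈-rights⁻ S (∈-⊎ˢ⁻ (lefts S) (rights S) b∈)

size-lefts+rights : (S : FinSet (A ⊎ B)) → size S ≡ size (lefts S) + size (rights S)
size-lefts+rights S =
  trans (size-cong S (lefts S ⊎ˢ rights S) (≈-lefts⊎ˢrights S)) (size-⊎ˢ (lefts S) (rights S))

-- Transversals

IsTr-unique : {𝓖 : Collection A} {s t : ℕ} → IsTr 𝓖 s → IsTr 𝓖 t → s ≡ t
IsTr-unique {s = s} {t} tr-s tr-t =
  let S , S-blocks , ∣S∣≡s = IsTr.attained tr-s ; T , T-blocks , ∣T∣≡t = IsTr.attained tr-t
  in ≤-antisym (subst (s ≤_) ∣T∣≡t (IsTr.minimal tr-s T T-blocks))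
               (subst (t ≤_) ∣S∣≡s (IsTr.minimal tr-t S S-blocks))

size-⊤ : {𝓖 : Collection A} {t : ℕ} → IsTr 𝓖 t → ∀ T → T ∈ 𝓖 ^⊤ → size T ≡ t
size-⊤ tr-t T (_ , tr-T) = IsTr-unique tr-T tr-t

blocking∧size≡tr⇒∈⊤ : {𝓖 : Collection A} {t : ℕ} → IsTr 𝓖 t →
                      ∀ T → IsBlockingSet 𝓖 ⟦ T ⟧ → size T ≡ t → T ∈ 𝓖 ^⊤
blocking∧size≡tr⇒∈⊤ {𝓖 = 𝓖} tr-t T T-blocks ∣T∣≡t = T-blocks , subst (IsTr 𝓖) (sym ∣T∣≡t) tr-t

-- A member of `𝓖 ^⊤` carries the proof that its own size is the transversal number, so one member
-- of known size suffices.
≐⊤⇒IsTr : {𝓖 𝓣 : Collection A} {t : ℕ} → 𝓣 ≐ 𝓖 ^⊤ → ∃[ T ] T ∈ 𝓣 → IsUniform 𝓣 t → IsTr 𝓖 t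
≐⊤⇒IsTr {𝓖 = 𝓖} (𝓣⊆ , _) (T , T∈𝓣) uniform = subst (IsTr 𝓖) (uniform T T∈𝓣) (proj₂ (𝓣⊆ T∈𝓣))

-- The criterion behind every computation of transversals below: the candidates block, and a
-- blocking set is at least as large as they are, with equality only for a candidate.
module _ {𝓖 𝓣 : Collection A} {t : ℕ} (nonempty : ∃[ T ] T ∈ 𝓣) (uniform : IsUniform 𝓣 t)
  (blocks : ∀ T → T ∈ 𝓣 → IsBlockingSet 𝓖 ⟦ T ⟧)
  (minimal : ∀ S → IsBlockingSet 𝓖 ⟦ S ⟧ → t ≤ size S × (size S ≡ t → S ∈ 𝓣)) where

  IsTr-intro : IsTr 𝓖 t
  IsTr-intro = record
    { attained = let T , T∈𝓣 = nonempty in T , blocks T T∈𝓣 , uniform T T∈𝓣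
    ; minimal  = λ S S-blocks → proj₁ (minimal S S-blocks)
    }

  ≐⊤-intro : 𝓣 ≐ 𝓖 ^⊤
  ≐⊤-intro =
    (λ {T} T∈𝓣 → blocking∧size≡tr⇒∈⊤ IsTr-intro T (blocks T T∈𝓣) (uniform T T∈𝓣)) ,
    (λ {T} T∈⊤ → proj₂ (minimal T (proj₁ T∈⊤)) (size-⊤ IsTr-intro T T∈⊤))

-- A finite list of representatives makes blocking decidable and turns a failure into an explicit
-- missed block. This provides constructively the case split of `⋈-minimal`.
blocks-or-misses : DecidableEquality A → {𝓖 : Collection A} {n : ℕ} → HasCardinality 𝓖 n →
                   ∀ S → IsBlockingSet 𝓖 ⟦ S ⟧ ⊎ (∃[ G ] G ∈ 𝓖 × ¬ (⟦ G ⟧ ≬ ⟦ S ⟧))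
blocks-or-misses {A} _≟_ (Gs , _ , _ , ∈𝓖⇔) S with Any.any? (λ G → ¬? (≬? _≟_ G S)) Gs
... | yes any = let G , G∈Gs , G#S = SetoidMembership.find (finSetSetoid A) any
                in inj₂ (G , Equivalence.from (∈𝓖⇔ G) G∈Gs , G#S)
... | no ¬any = inj₁ λ G G∈𝓖 → decidable-stable (≬? _≟_ G S) λ G#S →
  ¬any (Any.map (λ {H} (G⊆H , H⊆G) H≬S → G#S (≬-mono H⊆G (λ x∈ → x∈) H≬S))
    (Equivalence.to (∈𝓖⇔ G) G∈𝓖))

-- Extending the transversals of a CIF by the blocks of a MIF

infixr 6 _⋈_

-- The points of `𝓖` are new because the union lives on `A ⊎ B`. Members are taken up to `_≈_`, so
-- the order of elements is irrelevant.
_⋈_ : Collection A → Collection B → Collection (A ⊎ B)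
(𝓕 ⋈ 𝓖) S = (∃[ F ] F ∈ 𝓕 × S ≈ F ⊎ˢ ∅)
          ⊎ (∃[ T ] ∃[ G ] T ∈ 𝓕 ^⊤ × G ∈ 𝓖 × S ≈ T ⊎ˢ G)

module CIF⋈MIF {A B : Set} {k t s : ℕ} {𝓕 : Collection A} {𝓖 : Collection B}
  (𝓕-CIF : IsCIF k t 𝓕) (𝓖-MIF : IsMIF s 𝓖) (t+s≡k : t + s ≡ k) where

  private
    module 𝓕 = IsCIF 𝓕-CIF
    module 𝓖 = IsMIF 𝓖-MIF

  -- By closedness the blocks of `𝓕`, all of size `k`, are themselves transversals of this union.
  tr-𝓕∪𝓕⊤ : IsTr (𝓕 ∪ 𝓕 ^⊤) k
  tr-𝓕∪𝓕⊤ = ≐⊤⇒IsTr 𝓕.closed (IsFamily.nonempty 𝓕.isFamily) 𝓕.uniform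

  tr-𝓖 : IsTr 𝓖 s
  tr-𝓖 = ≐⊤⇒IsTr 𝓖.closed (IsFamily.nonempty 𝓖.isFamily) 𝓖.uniform

  -- Two blocks of `𝓕` meet, and so do a block and a transversal of `𝓕`, both on old points. Two
  -- transversals of `𝓕` may be disjoint, so two unions are made to meet on new points, where `𝓖` is
  -- intersecting because `𝓖` equals `𝓖 ^⊤`.
  ⋈-intersecting : ∀ S S′ → S ∈ 𝓕 ⋈ 𝓖 → S′ ∈ 𝓕 ⋈ 𝓖 → ⟦ S′ ⟧ ≬ ⟦ S ⟧
  ⋈-intersecting _ _ (inj₁ (F , F∈ , _ , ⊇)) (inj₁ (F′ , F′∈ , _ , ⊇′)) =
    ≬-mono ⊇′ ⊇ (≬-⊎ˢ⁺ˡ F′ F ∅ ∅ (proj₁ (𝓕.closed .proj₁ F∈) F′ (inj₁ F′∈)))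
  ⋈-intersecting _ _ (inj₁ (F , F∈ , _ , ⊇)) (inj₂ (T′ , G′ , T′∈ , _ , _ , ⊇′)) =
    ≬-mono ⊇′ ⊇ (≬-⊎ˢ⁺ˡ T′ F G′ ∅ (proj₁ (𝓕.closed .proj₁ F∈) T′ (inj₂ T′∈)))
  ⋈-intersecting _ _ (inj₂ (T , G , T∈ , _ , _ , ⊇)) (inj₁ (F′ , F′∈ , _ , ⊇′)) =
    ≬-mono ⊇′ ⊇ (≬-⊎ˢ⁺ˡ F′ T ∅ G (proj₁ T∈ F′ F′∈))
  ⋈-intersecting _ _ (inj₂ (T , G , _ , G∈ , _ , ⊇)) (inj₂ (T′ , G′ , _ , G′∈ , _ , ⊇′)) =
    ≬-mono ⊇′ ⊇ (≬-⊎ˢ⁺ʳ T′ T G′ G (proj₁ (𝓖.closed .proj₁ G∈) G′ G′∈))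

  ⋈-uniform : IsUniform (𝓕 ⋈ 𝓖) k
  ⋈-uniform S (inj₁ (F , F∈ , S≈)) =
    trans (size-cong S (F ⊎ˢ ∅) S≈)
      (trans (size-⊎ˢ F ∅) (trans (+-identityʳ (size F)) (𝓕.uniform F F∈)))
  ⋈-uniform S (inj₂ (T , G , T∈ , G∈ , S≈)) =
    trans (size-cong S (T ⊎ˢ G) S≈)
      (trans (size-⊎ˢ T G) (trans (cong₂ _+_ (size-⊤ 𝓕.tr T T∈) (𝓖.uniform G G∈)) t+s≡k))

  ⋈-isFamily : IsFamily (𝓕 ⋈ 𝓖)
  ⋈-isFamily = record
    { respects = λ
      { {S} {S′} S≈S′ (inj₁ (F , F∈ , S≈)) →
          inj₁ (F , F∈ , ≈-trans S′ S (F ⊎ˢ ∅) (≈-sym S S′ S≈S′) S≈)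
      ; {S} {S′} S≈S′ (inj₂ (T , G , T∈ , G∈ , S≈)) →
          inj₂ (T , G , T∈ , G∈ , ≈-trans S′ S (T ⊎ˢ G) (≈-sym S S′ S≈S′) S≈) }
    ; nonempty = let F , F∈ = IsFamily.nonempty 𝓕.isFamily
                 in F ⊎ˢ ∅ , inj₁ (F , F∈ , ≈-refl (F ⊎ˢ ∅))
    ; blocksNonempty = λ S S∈ → let x , x∈ , _ = ⋈-intersecting S S S∈ S∈ in x , x∈
    }

  module _ (S : FinSet (A ⊎ B)) (S-blocks : IsBlockingSet (𝓕 ⋈ 𝓖) ⟦ S ⟧) where

    lefts-blocks-𝓕 : IsBlockingSet 𝓕 ⟦ lefts S ⟧
    lefts-blocks-𝓕 F F∈ with S-blocks (F ⊎ˢ ∅) (inj₁ (F , F∈ , ≈-refl (F ⊎ˢ ∅)))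
    ... | inj₁ a , a∈F , a∈S = a , ∈-⊎ˢ⁻ F ∅ a∈F , ∈-lefts⁺ S a∈S
    ... | inj₂ b , b∈∅ , _   with () ← ∈-⊎ˢ⁻ F ∅ b∈∅

    -- Since `S` avoids `G`, it can meet `T ⊎ˢ G` only inside `T`, for every transversal `T`.
    lefts-blocks-𝓕⊤ : ∀ G → G ∈ 𝓖 → ¬ (⟦ G ⟧ ≬ ⟦ rights S ⟧) → IsBlockingSet (𝓕 ^⊤) ⟦ lefts S ⟧
    lefts-blocks-𝓕⊤ G G∈ G#S T T∈ with S-blocks (T ⊎ˢ G) (inj₂ (T , G , T∈ , G∈ , ≈-refl (T ⊎ˢ G)))
    ... | inj₁ a , a∈T , a∈S = a , ∈-⊎ˢ⁻ T G a∈T , ∈-lefts⁺ S a∈S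
    ... | inj₂ b , b∈G , b∈S = contradiction (b , ∈-⊎ˢ⁻ T G b∈G , ∈-rights⁺ S b∈S) G#S

    -- If the new points of S block 𝓖, then S has at least t old and s new points;
    -- otherwise its old points block 𝓕 ∪ 𝓕 ^⊤, so there are at least k of them.
    ⋈-minimal : IsBlockingSet 𝓖 ⟦ rights S ⟧ ⊎ (∃[ G ] G ∈ 𝓖 × ¬ (⟦ G ⟧ ≬ ⟦ rights S ⟧)) →
                k ≤ size S × (size S ≡ k → S ∈ 𝓕 ⋈ 𝓖)
    ⋈-minimal (inj₁ R-blocks) =
      subst (k ≤_) (sym ∣S∣≡l+r) (subst (_≤ l + r) t+s≡k (+-mono-≤ t≤l s≤r)) ,
      λ ∣S∣≡k →
        let l+r≡t+s = trans (sym ∣S∣≡l+r) (trans ∣S∣≡k (sym t+s≡k))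
            -- The bounds `t≤l` and `s≤r` already add up to the whole sum, so neither has any slack.
            l≡t = ≤-antisym (+-cancelʳ-≤ s l t (≤-trans (+-monoʳ-≤ l s≤r) (≤-reflexive l+r≡t+s))) t≤l
            r≡s = ≤-antisym (+-cancelˡ-≤ t r s (≤-trans (+-monoˡ-≤ r t≤l) (≤-reflexive l+r≡t+s))) s≤r
        in inj₂ (lefts S , rights S
                , blocking∧size≡tr⇒∈⊤ 𝓕.tr (lefts S) lefts-blocks-𝓕 l≡t
                , 𝓖.closed .proj₂ (blocking∧size≡tr⇒∈⊤ tr-𝓖 (rights S) R-blocks r≡s)
                , ≈-lefts⊎ˢrights S)
      where
      l = size (lefts S)
      r = size (rights S)
      ∣S∣≡l+r = size-lefts+rights S
      t≤l = IsTr.minimal 𝓕.tr (lefts S) lefts-blocks-𝓕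
      s≤r = IsTr.minimal tr-𝓖 (rights S) R-blocks
    ⋈-minimal (inj₂ (G , G∈ , G#S)) =
      subst (k ≤_) (sym ∣S∣≡l+r) (≤-trans k≤l (m≤m+n l r)) ,
      λ ∣S∣≡k →
        let l+r≡k = trans (sym ∣S∣≡l+r) ∣S∣≡k
            -- The old points alone use up all `k` elements, which leaves no new point.
            l≡k = ≤-antisym (subst (l ≤_) l+r≡k (m≤m+n l r)) k≤l
            r≡0 = +-cancelˡ-≡ l r 0 (trans l+r≡k (trans (sym l≡k) (sym (+-identityʳ l))))
        in inj₁ (lefts S
                , 𝓕.closed .proj₂ (blocking∧size≡tr⇒∈⊤ tr-𝓕∪𝓕⊤ (lefts S) L-blocks l≡k)
                , ≈-trans S (lefts S ⊎ˢ rights S) (lefts S ⊎ˢ ∅) (≈-lefts⊎ˢrights S)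
                    (⊎ˢ-cong (lefts S) (lefts S) (rights S) ∅
                      (≈-refl (lefts S)) (size-0⇒≈∅ (rights S) r≡0)))
      where
      l = size (lefts S)
      r = size (rights S)
      ∣S∣≡l+r = size-lefts+rights S
      L-blocks : IsBlockingSet (𝓕 ∪ 𝓕 ^⊤) ⟦ lefts S ⟧
      L-blocks F = [ lefts-blocks-𝓕 F , lefts-blocks-𝓕⊤ G G∈ G#S F ]′
      k≤l = IsTr.minimal tr-𝓕∪𝓕⊤ (lefts S) L-blocks

  -- The dichotomy for `𝓖` is a hypothesis because it is not decidable for an arbitrary collection.
  -- Any single block serves as the finite blocking set.
  ⋈-isMIF : (∀ R → IsBlockingSet 𝓖 ⟦ R ⟧ ⊎ (∃[ G ] G ∈ 𝓖 × ¬ (⟦ G ⟧ ≬ ⟦ R ⟧))) → IsMIF k (𝓕 ⋈ 𝓖)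
  ⋈-isMIF 𝓖-blocks? = record
    { isFamily = ⋈-isFamily
    ; uniform  = ⋈-uniform
    ; finiteTr = let S , S∈ = IsFamily.nonempty ⋈-isFamily
                 in S , λ S′ S′∈ → ⋈-intersecting S S′ S∈ S′∈
    ; closed   = ≐⊤-intro (IsFamily.nonempty ⋈-isFamily) ⋈-uniform
                   (λ S S∈ S′ S′∈ → ⋈-intersecting S S′ S∈ S′∈)
                   (λ S S-blocks → ⋈-minimal S S-blocks (𝓖-blocks? (rights S)))
    }

-- Counting the blocks of `𝓕 ⋈ 𝓖`

length-cartesianProductWith : {A B C : Set} (f : A → B → C) (xs : List A) (ys : List B) →
                              length (cartesianProductWith f xs ys) ≡ length xs * length ys
length-cartesianProductWith f []       ys = refl
length-cartesianProductWith f (x ∷ xs) ys = trans (length-++ (map (f x) ys))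
  (cong₂ _+_ (length-map (f x) ys) (length-cartesianProductWith f xs ys))

-- The unions are counted by pairs `(T , G)` since `_⊎ˢ_` is injective. None of them equals a block
-- `F ⊎ˢ ∅`, because `G` has a point.
⋈-cardinality : {𝓕 : Collection A} {𝓖 : Collection B} {m n l : ℕ} →
                (∀ G → G ∈ 𝓖 → ∃[ x ] x ∈ ⟦ G ⟧) →
                HasCardinality 𝓕 m → HasCardinality (𝓕 ^⊤) n → HasCardinality 𝓖 l →
                HasCardinality (𝓕 ⋈ 𝓖) (m + n * l)
⋈-cardinality {A} {B} {𝓕} {𝓖} nonempty
  (Fs , Fs! , refl , ∈Fs⇔) (Ts , Ts! , refl , ∈Ts⇔) (Gs , Gs! , refl , ∈Gs⇔) =
    Ss
  , SetoidUnique.++⁺ 𝕊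
      (SetoidUnique.map⁺ 𝔸 𝕊 (λ {F} {F′} eq → proj₁ (⊎ˢ-injective F F′ ∅ ∅ eq)) Fs!)
      (SetoidUnique.cartesianProductWith⁺ 𝔸 𝔹 𝕊 _⊎ˢ_
        (λ {T} {T′} {G} {G′} → ⊎ˢ-injective T T′ G G′) Ts! Gs!)
      (λ {S} → disjoint {S})
  , trans (length-++ (map (_⊎ˢ ∅) Fs))
      (cong₂ _+_ (length-map (_⊎ˢ ∅) Fs) (length-cartesianProductWith _⊎ˢ_ Ts Gs))
  , λ S → mk⇔ (to {S}) (from {S})
  where
  𝔸 = finSetSetoid A
  𝔹 = finSetSetoid B
  𝕊 = finSetSetoid (A ⊎ B)
  open SetoidMembership 𝕊 using () renaming (_∈_ to _∈ₛ_)

  Ss : List (FinSet (A ⊎ B))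
  Ss = map (_⊎ˢ ∅) Fs ++ cartesianProductWith _⊎ˢ_ Ts Gs

  disjoint : ∀ {S} → ¬ (S ∈ₛ map (_⊎ˢ ∅) Fs × S ∈ₛ cartesianProductWith _⊎ˢ_ Ts Gs)
  disjoint {S} (S∈₁ , S∈₂) =
    let F , _ , S≈F = SetoidMembershipₚ.∈-map⁻ 𝔸 𝕊 {S} {Fs} {_⊎ˢ ∅} S∈₁
        T , G , _ , G∈ , S≈TG = SetoidMembershipₚ.∈-cartesianProductWith⁻ 𝔸 𝔹 𝕊 _⊎ˢ_ Ts Gs {S} S∈₂
        x , x∈G = nonempty G (Equivalence.from (∈Gs⇔ G) G∈)
        _ , G⊆∅ = ⊎ˢ-injective-⊆ T F G ∅ (proj₁ (≈-trans (T ⊎ˢ G) S (F ⊎ˢ ∅) (≈-sym S (T ⊎ˢ G) S≈TG) S≈F))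
    in case G⊆∅ x∈G of λ ()

  to : ∀ {S} → S ∈ 𝓕 ⋈ 𝓖 → S ∈ₛ Ss
  to {S} (inj₁ (F , F∈ , S≈)) = SetoidMembershipₚ.∈-resp-≈ 𝕊 {_} {F ⊎ˢ ∅} {S} (≈-sym S (F ⊎ˢ ∅) S≈)
    (SetoidMembershipₚ.∈-++⁺ˡ 𝕊 {F ⊎ˢ ∅} (SetoidMembershipₚ.∈-map⁺ 𝔸 𝕊 {_⊎ˢ ∅}
      (λ {F} {F′} eq → ⊎ˢ-cong F F′ ∅ ∅ eq (≈-refl ∅)) {F} {Fs} (Equivalence.to (∈Fs⇔ F) F∈)))
  to {S} (inj₂ (T , G , T∈ , G∈ , S≈)) =
    SetoidMembershipₚ.∈-resp-≈ 𝕊 {_} {T ⊎ˢ G} {S} (≈-sym S (T ⊎ˢ G) S≈)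
    (SetoidMembershipₚ.∈-++⁺ʳ 𝕊 {T ⊎ˢ G} (map (_⊎ˢ ∅) Fs) (SetoidMembershipₚ.∈-cartesianProductWith⁺ 𝔸 𝔹 𝕊
      (λ {T} {T′} {G} {G′} → ⊎ˢ-cong T T′ G G′) {Ts} {Gs} {T} {G}
      (Equivalence.to (∈Ts⇔ T) T∈) (Equivalence.to (∈Gs⇔ G) G∈)))

  from : ∀ {S} → S ∈ₛ Ss → S ∈ 𝓕 ⋈ 𝓖
  from {S} S∈ with SetoidMembershipₚ.∈-++⁻ 𝕊 {S} (map (_⊎ˢ ∅) Fs) S∈
  ... | inj₁ S∈₁ = let F , F∈ , S≈ = SetoidMembershipₚ.∈-map⁻ 𝔸 𝕊 {S} {Fs} {_⊎ˢ ∅} S∈₁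
                   in inj₁ (F , Equivalence.from (∈Fs⇔ F) F∈ , S≈)
  ... | inj₂ S∈₂ =
    let T , G , T∈ , G∈ , S≈ = SetoidMembershipₚ.∈-cartesianProductWith⁻ 𝔸 𝔹 𝕊 _⊎ˢ_ Ts Gs {S} S∈₂
    in inj₂ (T , G , Equivalence.from (∈Ts⇔ T) T∈ , Equivalence.from (∈Gs⇔ G) G∈ , S≈)

-- Families given by a list of blocks

⟨_⟩ : List (FinSet A) → Collection A
⟨_⟩ {A} Bs S = S ∈ₛ Bs
  where open SetoidMembership (finSetSetoid A) using () renaming (_∈_ to _∈ₛ_)

module _ {Bs : List (FinSet A)} where

  ∈⟨⟩⁺ : ∀ {B} → B ∈ˡ Bs → B ∈ ⟨ Bs ⟩
  ∈⟨⟩⁺ {B} B∈ = Any.map (λ { refl → ≈-refl B }) B∈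

  ∈⟨⟩⁻ : ∀ {S} → S ∈ ⟨ Bs ⟩ → ∃[ B ] B ∈ˡ Bs × S ≈ B
  ∈⟨⟩⁻ = find

  ⟨⟩-respects : ⟨ Bs ⟩ Respects _≈_
  ⟨⟩-respects {S} {T} S≈T S∈ =
    Any.map (λ {B} S≈B → ≈-trans T S B (≈-sym S T S≈T) S≈B) S∈

  ⟨⟩-uniform : ∀ {k} → All (λ B → size B ≡ k) Bs → IsUniform ⟨ Bs ⟩ k
  ⟨⟩-uniform sizes S S∈ =
    let B , B∈ , S≈B = ∈⟨⟩⁻ {S} S∈ in trans (size-cong S B S≈B) (All.lookup sizes B∈)

  ⟨⟩-cardinality : {𝓖 : Collection A} → 𝓖 ≐ ⟨ Bs ⟩ →
                   SetoidUnique (finSetSetoid A) Bs → HasCardinality 𝓖 (length Bs)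
  ⟨⟩-cardinality (𝓖⊆ , 𝓖⊇) Bs! = Bs , Bs! , refl , λ S → mk⇔ (𝓖⊆ {S}) (𝓖⊇ {S})

-- Reduces blocking to pairs of listed representatives, which is a finite check.
⟨⟩-blocks : {Ts Bs : List (FinSet A)} → (∀ T B → T ∈ˡ Ts → B ∈ˡ Bs → ⟦ B ⟧ ≬ ⟦ T ⟧) →
            ∀ T → T ∈ ⟨ Ts ⟩ → IsBlockingSet ⟨ Bs ⟩ ⟦ T ⟧
⟨⟩-blocks Ts≬Bs T T∈ B B∈ =
  let T′ , T′∈ , _ , ⊇T = ∈⟨⟩⁻ {S = T} T∈ ; B′ , B′∈ , _ , ⊇B = ∈⟨⟩⁻ {S = B} B∈
  in ≬-mono ⊇B ⊇T (Ts≬Bs T′ B′ T′∈ B′∈)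

-- Combinatorial arguments yield only containment of some member. Containment bounds the size from
-- below, and at equal size it becomes equality of sets.
contains⇒minimal : DecidableEquality A → {𝓣 : Collection A} {t : ℕ} →
                   𝓣 Respects _≈_ → IsUniform 𝓣 t →
                   ∀ S → ∃[ T ] T ∈ 𝓣 × ⟦ T ⟧ ⊆ ⟦ S ⟧ → t ≤ size S × (size S ≡ t → S ∈ 𝓣)
contains⇒minimal _≟_ {t = t} respects uniform S (T , T∈ , T⊆S) =
  subst (_≤ size S) ∣T∣≡t (size-mono T S T⊆S) ,
  λ ∣S∣≡t → respects {T} {S}
    (T⊆S , ⊆∧size-≤⇒⊇ _≟_ T S T⊆S (≤-reflexive (trans ∣S∣≡t (sym ∣T∣≡t)))) T∈
  where ∣T∣≡t = uniform T T∈

module Decide (_≟_ : DecidableEquality A) where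

  ⊆? : (S T : FinSet A) → Dec (⟦ S ⟧ ⊆ ⟦ T ⟧)
  ⊆? S T = map′ (λ all {x} → All.lookup all {x}) (λ S⊆T → All.tabulate S⊆T)
    (All.all? (∈? _≟_ T) (FinSet.elements S))

  unique? : ∀ Bs → Dec (SetoidUnique (finSetSetoid A) Bs)
  unique? = allPairs? λ S T → ¬? (⊆? S T ×-dec ⊆? T S)

  pairwise-≬? : ∀ Ts Bs → Dec (∀ T B → T ∈ˡ Ts → B ∈ˡ Bs → ⟦ B ⟧ ≬ ⟦ T ⟧)
  pairwise-≬? Ts Bs = map′
    (λ all _ _ T∈ B∈ → All.lookup (All.lookup all T∈) B∈)
    (λ meet → All.tabulate λ T∈ → All.tabulate λ B∈ → meet _ _ T∈ B∈)
    (All.all? (λ T → All.all? (λ B → ≬? _≟_ B T) Bs) Ts)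

-- The triangle

pair₀₁ pair₁₂ pair₂₀ : FinSet (Fin 3)
pair₀₁ = finSet (0F ∷ 1F ∷ []) (((λ ()) ∷ []) ∷ [] ∷ [])
pair₁₂ = finSet (1F ∷ 2F ∷ []) (((λ ()) ∷ []) ∷ [] ∷ [])
pair₂₀ = finSet (2F ∷ 0F ∷ []) (((λ ()) ∷ []) ∷ [] ∷ [])

pairs : List (FinSet (Fin 3))
pairs = pair₀₁ ∷ pair₁₂ ∷ pair₂₀ ∷ []

pairs-cardinality : HasCardinality ⟨ pairs ⟩ 3
pairs-cardinality = ⟨⟩-cardinality ((λ x → x) , (λ x → x)) (from-yes (Decide.unique? Fin._≟_ pairs))

pair-⊆ : {x y : A} {xs : List A} → x ∈ˡ xs → y ∈ˡ xs → (_∈ˡ (x ∷ y ∷ [])) ⊆ (_∈ˡ xs)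
pair-⊆ x∈ y∈ (here refl)         = x∈
pair-⊆ x∈ y∈ (there (here refl)) = y∈

-- No vertex lies on all three edges, so the points where `S` meets them include two distinct
-- vertices, and any two vertices form an edge.
blocking⇒contains-pair : ∀ S → IsBlockingSet ⟨ pairs ⟩ ⟦ S ⟧ → ∃[ P ] P ∈ ⟨ pairs ⟩ × ⟦ P ⟧ ⊆ ⟦ S ⟧
blocking⇒contains-pair S S-blocks =
  pick (S-blocks pair₀₁ 01∈) (S-blocks pair₁₂ 12∈) (S-blocks pair₂₀ 20∈)
  where
  01∈ = ∈⟨⟩⁺ {Bs = pairs} {pair₀₁} (here refl)
  12∈ = ∈⟨⟩⁺ {Bs = pairs} {pair₁₂} (there (here refl))
  20∈ = ∈⟨⟩⁺ {Bs = pairs} {pair₂₀} (there (there (here refl)))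
  pick : ⟦ pair₀₁ ⟧ ≬ ⟦ S ⟧ → ⟦ pair₁₂ ⟧ ≬ ⟦ S ⟧ → ⟦ pair₂₀ ⟧ ≬ ⟦ S ⟧ →
         ∃[ P ] P ∈ ⟨ pairs ⟩ × ⟦ P ⟧ ⊆ ⟦ S ⟧
  pick (_ , here refl , 0∈)         (_ , here refl , 1∈)         _ = pair₀₁ , 01∈ , pair-⊆ 0∈ 1∈
  pick (_ , here refl , 0∈)         (_ , there (here refl) , 2∈) _ = pair₂₀ , 20∈ , pair-⊆ 2∈ 0∈
  pick (_ , there (here refl) , 1∈) (_ , there (here refl) , 2∈) _ = pair₁₂ , 12∈ , pair-⊆ 1∈ 2∈
  -- The remaining case has the first two edges met in their common vertex `1F`; the third edge then
  -- supplies a second vertex.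
  pick (_ , there (here refl) , 1∈) _ (_ , here refl , 2∈)         = pair₁₂ , 12∈ , pair-⊆ 1∈ 2∈
  pick (_ , there (here refl) , 1∈) _ (_ , there (here refl) , 0∈) = pair₀₁ , 01∈ , pair-⊆ 0∈ 1∈

pairs-isMIF : IsMIF 2 ⟨ pairs ⟩
pairs-isMIF = record
  { isFamily = record
    { respects       = λ {S} {T} → ⟨⟩-respects {x = S} {T}
    ; nonempty       = nonempty
    ; blocksNonempty = λ P P∈ → let x , x∈ , _ = intersecting P P∈ P P∈ in x , x∈
    }
  ; uniform  = uniform
  ; finiteTr = let P , P∈ = nonempty in P , intersecting P P∈
  ; closed   = ≐⊤-intro nonempty uniform intersecting λ S S-blocks →
      contains⇒minimal Fin._≟_ (λ {S} {T} → ⟨⟩-respects {x = S} {T}) uniform S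
        (blocking⇒contains-pair S S-blocks)
  }
  where
  nonempty     = pair₀₁ , ∈⟨⟩⁺ {Bs = pairs} {pair₀₁} (here refl)
  uniform      = ⟨⟩-uniform {Bs = pairs} (refl ∷ refl ∷ refl ∷ [])
  intersecting = ⟨⟩-blocks (from-yes (Decide.pairwise-≬? Fin._≟_ pairs pairs))

-- The blocks of 𝔽 5 3

-- `∣X∣` branches on `n`, so it computes only for a concrete `n`. Casting along this equation gives
-- all three sets the common index type `Fin 4`.
∣X∣≡4 : ∀ n → ∣X∣ 5 3 (toℕ {3} n) ≡ 4
∣X∣≡4 0F = refl
∣X∣≡4 1F = refl
∣X∣≡4 2F = refl

pt : Fin 3 → Fin 4 → Point 5 3
pt n q = n , cast (sym (∣X∣≡4 n)) q

pt-surjective : ∀ n q → pt n (cast (∣X∣≡4 n) q) ≡ (n , q)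
pt-surjective n q = cong (n ,_) (Fin.cast-involutive (sym (∣X∣≡4 n)) (∣X∣≡4 n) q)

position : Point 5 3 → Fin 4
position (n , q) = cast (∣X∣≡4 n) q

pt-injective : ∀ {n q q′} → pt n q ≡ pt n q′ → q ≡ q′
pt-injective {n} {q} {q′} eq =
  trans (sym (position-pt q)) (trans (cong position eq) (position-pt q′))
  where
  position-pt : ∀ q → position (pt n q) ≡ q
  position-pt = Fin.cast-involutive (∣X∣≡4 n) (sym (∣X∣≡4 n))

_≟ᴾ_ : DecidableEquality (Point 5 3)
_≟ᴾ_ = ≡-dec Fin._≟_ Fin._≟_

next : Fin 3 → Fin 3
next 0F = 1F
next 1F = 2F
next 2F = 0F

toℕ-next : ∀ n → toℕ (next n) ≡ (toℕ n + 1) % 3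
toℕ-next 0F = refl
toℕ-next 1F = refl
toℕ-next 2F = refl

next³ : ∀ n → next (next (next n)) ≡ n
next³ 0F = refl
next³ 1F = refl
next³ 2F = refl

n≢next : ∀ n → n ≢ next n
n≢next 0F ()
n≢next 1F ()
n≢next 2F ()

n≢next² : ∀ n → n ≢ next (next n)
n≢next² 0F ()
n≢next² 1F ()
n≢next² 2F ()

-- A path has the single point with `i = 1`, and `p 1` is 0 or 1; hence `r` ranges over `Fin 2` and
-- is embedded into `Fin 4`.
blockElements : Fin 3 → Fin 2 → List (Point 5 3)
blockElements n r = pt (next n) (r ↑ˡ 2) ∷ map (pt n) (allFin 4)

block : Fin 3 → Fin 2 → FinSet (Point 5 3)
block n r = finSet (blockElements n r) (unique n r)
  where
  unique : ∀ n r → Unique (blockElements n r)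
  unique = from-yes (Fin.all? λ n → Fin.all? λ r → allPairs? (λ x y → ¬? (x ≟ᴾ y)) (blockElements n r))

∈-block : ∀ n r {x} → x ∈ ⟦ block n r ⟧ → x ≡ pt (next n) (r ↑ˡ 2) ⊎ ∃[ q ] x ≡ pt n q
∈-block n r (here x≡)  = inj₁ x≡
∈-block n r (there x∈) = let q , _ , x≡ = ∈-map⁻ (pt n) x∈ in inj₂ (q , x≡)

pt∈block : ∀ n r q → pt n q ∈ ⟦ block n r ⟧
pt∈block n r q = there (∈-map⁺ (pt n) (∈-allFin q))

block-⊆ : ∀ n r S → pt (next n) (r ↑ˡ 2) ∈ ⟦ S ⟧ → (∀ q → pt n q ∈ ⟦ S ⟧) → ⟦ block n r ⟧ ⊆ ⟦ S ⟧
block-⊆ n r S r∈ all∈ x∈ with ∈-block n r x∈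
... | inj₁ refl       = r∈
... | inj₂ (q , refl) = all∈ q

-- As `5 ∸ 4 = 1`, the bounds on `i` force `i = 1`, so `p` enters only through `p 1`.
block≐X∪Path : ∀ n r p → toℕ r ≡ p 1 → ⟦ block n r ⟧ ≐ X {5} {3} n ∪ Path {5} {3} n p
block≐X∪Path n r p r≡p₁ = to , from
  where
  to : ⟦ block n r ⟧ ⊆ X {5} {3} n ∪ Path {5} {3} n p
  to x∈ with ∈-block n r x∈
  ... | inj₂ (q , refl) = inj₁ refl
  ... | inj₁ refl = inj₂ (1 , s≤s z≤n , ≤-reflexive (sym (cong (5 ∸_) (∣X∣≡4 n))) , toℕ-next n ,
    trans (Fin.toℕ-cast (sym (∣X∣≡4 (next n))) (r ↑ˡ 2)) (trans (Fin.toℕ-↑ˡ r 2) r≡p₁))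

  from : X {5} {3} n ∪ Path {5} {3} n p ⊆ ⟦ block n r ⟧
  from {n , q} (inj₁ refl) = subst (_∈ ⟦ block n r ⟧) (pt-surjective n q) (pt∈block n r _)
  from {m , q} (inj₂ (i , 1≤i , i≤ , m≡ , q≡)) = here (begin
    m , q                           ≡⟨ pt-surjective m q ⟨
    pt m (cast (∣X∣≡4 m) q)         ≡⟨ cong₂ pt m≡next q≡r ⟩
    pt (next n) (r ↑ˡ 2)            ∎)
    where
    open ≡-Reasoning
    i≡1 : i ≡ 1
    i≡1 = ≤-antisym (subst (i ≤_) (cong (5 ∸_) (∣X∣≡4 n)) i≤) 1≤i
    m≡next : m ≡ next n
    m≡next = Fin.toℕ-injective (trans m≡ (trans (cong (λ j → (toℕ n + j) % 3) i≡1) (sym (toℕ-next n))))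
    q≡r : cast (∣X∣≡4 m) q ≡ r ↑ˡ 2
    q≡r = Fin.toℕ-injective (begin
      toℕ (cast (∣X∣≡4 m) q) ≡⟨ Fin.toℕ-cast (∣X∣≡4 m) q ⟩
      toℕ q                  ≡⟨ q≡ ⟩
      p i                    ≡⟨ cong p i≡1 ⟩
      p 1                    ≡⟨ r≡p₁ ⟨
      toℕ r                  ≡⟨ Fin.toℕ-↑ˡ r 2 ⟨
      toℕ (r ↑ˡ 2)           ∎)

blocks : List (FinSet (Point 5 3))
blocks = cartesianProductWith block (allFin 3) (allFin 2)

∈-blocks : ∀ {B} → B ∈ˡ blocks → ∃[ n ] ∃[ r ] B ≡ block n r
∈-blocks B∈ =
  let n , r , _ , _ , B≡ = ∈-cartesianProductWith⁻ block (allFin 3) (allFin 2) B∈ in n , r , B≡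

block∈blocks : ∀ n r → block n r ∈ ⟨ blocks ⟩
block∈blocks n r = ∈⟨⟩⁺ (∈-cartesianProductWith⁺ block (∈-allFin n) (∈-allFin r))

blocks-uniform : IsUniform ⟨ blocks ⟩ 5
blocks-uniform = ⟨⟩-uniform (from-yes (All.all? (λ B → size B ℕ.≟ 5) blocks))

𝔽≐blocks : 𝔽 5 3 ≐ ⟨ blocks ⟩
𝔽≐blocks = (λ {S} → to {S}) , (λ {S} → from {S})
  where
  to : 𝔽 5 3 ⊆ ⟨ blocks ⟩
  to {S} (_ , n , p , (p₀≡0 , step) , S≐) =
    ⟨⟩-respects {x = block n r} {S} (≐-trans (block≐X∪Path n r p (Fin.toℕ-fromℕ< p₁<2)) (≐-sym S≐))
      (block∈blocks n r)
    where
    -- The sequence starts at 0 and rises by at most one.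
    p₁<2 : p 1 < 2
    p₁<2 = s≤s (subst (λ p₀ → p 1 ≤ p₀ + 1) p₀≡0 (proj₂ (step 0)))
    r = fromℕ< p₁<2

  from : ⟨ blocks ⟩ ⊆ 𝔽 5 3
  from {S} S∈ =
    let B , B∈ , S≈B = ∈⟨⟩⁻ {S = S} S∈ ; n , r , B≡ = ∈-blocks B∈
    in blocks-uniform S S∈ , n , path r , (refl , step r)
     , ≐-trans (subst (S ≈_) B≡ S≈B) (block≐X∪Path n r (path r) refl)
    where
    -- The sequence 0, r, r, r, ... is admissible because `r` is at most 1.
    path : Fin 2 → ℕ → ℕ
    path r zero    = 0
    path r (suc _) = toℕ r
    step : ∀ r i → path r i ≤ path r (suc i) × path r (suc i) ≤ path r i + 1
    step r zero    = z≤n , s≤s⁻¹ (Fin.toℕ<n r)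
    step r (suc _) = ≤-refl , m≤m+n (toℕ r) 1

abstract
  block∈𝔽 : ∀ n r → block n r ∈ 𝔽 5 3
  block∈𝔽 n r = proj₂ 𝔽≐blocks {block n r} (block∈blocks n r)

-- The transversals of 𝔽 5 3

-- These are the 64 transversals meeting every Xₙ. The last two coordinates are paired so that a
-- binary product can enumerate the triples.
rainbow : Fin 4 → Fin 4 × Fin 4 → FinSet (Point 5 3)
rainbow a (b , c) = finSet (pt 0F a ∷ pt 1F b ∷ pt 2F c ∷ [])
  (((λ ()) ∷ (λ ()) ∷ []) ∷ ((λ ()) ∷ []) ∷ [] ∷ [])

-- These give the 12 transversals missing Xₙ: the two blocks of index n force the first two points,
-- and the blocks of index n + 2 are met in the third.
skewElements : Fin 3 → Fin 4 → List (Point 5 3)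
skewElements n q = pt (next n) 0F ∷ pt (next n) 1F ∷ pt (next (next n)) q ∷ []

skew : Fin 3 → Fin 4 → FinSet (Point 5 3)
skew n q = finSet (skewElements n q) (unique n q)
  where
  unique : ∀ n q → Unique (skewElements n q)
  unique = from-yes (Fin.all? λ n → Fin.all? λ q → allPairs? (λ x y → ¬? (x ≟ᴾ y)) (skewElements n q))

rainbows skews transversals : List (FinSet (Point 5 3))
rainbows     = cartesianProductWith rainbow (allFin 4) (cartesianProduct (allFin 4) (allFin 4))
skews        = cartesianProductWith skew (allFin 3) (allFin 4)
transversals = rainbows ++ skews

abstract
  rainbow∈ : ∀ a b c → rainbow a (b , c) ∈ ⟨ transversals ⟩
  rainbow∈ a b c = ∈⟨⟩⁺ (∈-++⁺ˡ
    (∈-cartesianProductWith⁺ rainbow (∈-allFin a) (∈-cartesianProduct⁺ (∈-allFin b) (∈-allFin c))))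

  skew∈ : ∀ n q → skew n q ∈ ⟨ transversals ⟩
  skew∈ n q = ∈⟨⟩⁺ (∈-++⁺ʳ rainbows (∈-cartesianProductWith⁺ skew (∈-allFin n) (∈-allFin q)))

transversals-uniform : IsUniform ⟨ transversals ⟩ 3
transversals-uniform = ⟨⟩-uniform (from-yes (All.all? (λ T → size T ℕ.≟ 3) transversals))

rainbow≬block : ∀ n r a b c → ⟦ block n r ⟧ ≬ ⟦ rainbow a (b , c) ⟧
rainbow≬block 0F r a b c = _ , pt∈block 0F r a , here refl
rainbow≬block 1F r a b c = _ , pt∈block 1F r b , there (here refl)
rainbow≬block 2F r a b c = _ , pt∈block 2F r c , there (there (here refl))

rotation : ∀ m n → n ≡ m ⊎ n ≡ next m ⊎ n ≡ next (next m)
rotation = from-yes (Fin.all? λ m → Fin.all? λ n →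
  (n Fin.≟ m) ⊎-dec (n Fin.≟ next m) ⊎-dec (n Fin.≟ next (next m)))

-- For n = m the extra point of the block is one of the two fixed points of the skew set. For n = m
-- + 1 and n = m + 2 the block contains the whole of Xₙ, in which the skew set has a point.
skew≬block : ∀ n r m q → ⟦ block n r ⟧ ≬ ⟦ skew m q ⟧
skew≬block n r m q with rotation m n
skew≬block n 0F m q | inj₁ refl        = _ , here refl , here refl
skew≬block n 1F m q | inj₁ refl        = _ , here refl , there (here refl)
skew≬block n r  m q | inj₂ (inj₁ refl) = _ , pt∈block n r 0F , here refl
skew≬block n r  m q | inj₂ (inj₂ refl) = _ , pt∈block n r q , there (there (here refl))

∈-rainbows : ∀ {T} → T ∈ˡ rainbows → ∃[ a ] ∃[ b ] ∃[ c ] T ≡ rainbow a (b , c)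
∈-rainbows T∈ =
  let a , (b , c) , _ , _ , T≡ =
        ∈-cartesianProductWith⁻ rainbow (allFin 4) (cartesianProduct (allFin 4) (allFin 4)) T∈
  in a , b , c , T≡

∈-skews : ∀ {T} → T ∈ˡ skews → ∃[ n ] ∃[ q ] T ≡ skew n q
∈-skews T∈ =
  let n , q , _ , _ , T≡ = ∈-cartesianProductWith⁻ skew (allFin 3) (allFin 4) T∈ in n , q , T≡

transversals≬blocks : ∀ T B → T ∈ˡ transversals → B ∈ˡ blocks → ⟦ B ⟧ ≬ ⟦ T ⟧
transversals≬blocks T B T∈ B∈ =
  let n , r , B≡ = ∈-blocks B∈
  in subst (λ B → ⟦ B ⟧ ≬ ⟦ T ⟧) (sym B≡) ([ meets-rainbow n r , meets-skew n r ]′ (∈-++⁻ rainbows T∈))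
  where
  meets-rainbow : ∀ n r → T ∈ˡ rainbows → ⟦ block n r ⟧ ≬ ⟦ T ⟧
  meets-rainbow n r T∈ =
    let a , b , c , T≡ = ∈-rainbows T∈
    in subst (λ T → ⟦ block n r ⟧ ≬ ⟦ T ⟧) (sym T≡) (rainbow≬block n r a b c)
  meets-skew : ∀ n r → T ∈ˡ skews → ⟦ block n r ⟧ ≬ ⟦ T ⟧
  meets-skew n r T∈ =
    let m , q , T≡ = ∈-skews T∈
    in subst (λ T → ⟦ block n r ⟧ ≬ ⟦ T ⟧) (sym T≡) (skew≬block n r m q)

-- The three points lie in different Xₙ, so each can only match the point in the same position.
rainbow-injective : ∀ {a a′ bc bc′} → rainbow a bc ≈ rainbow a′ bc′ → a ≡ a′ × bc ≡ bc′
rainbow-injective (sub , _)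
  with sub (here refl) | sub (there (here refl)) | sub (there (there (here refl)))
... | here a≡                   | there (here b≡)           | there (there (here c≡)) =
  pt-injective a≡ , cong₂ _,_ (pt-injective b≡) (pt-injective c≡)
... | there (here ())           | _                         | _
... | there (there (here ()))   | _                         | _
... | _                         | here ()                   | _
... | _                         | there (there (here ()))   | _
... | _                         | _                         | here ()
... | _                         | _                         | there (here ())

-- skew n q does not meet Xₙ.
rainbow≉skew : ∀ a b c n q → ¬ (rainbow a (b , c) ≈ skew n q)
rainbow≉skew a b c n q (sub , _) = case rainbow≬X n of λ (p , p∈) → case sub p∈ of λ
  { (here eq)                 → n≢next n (cong proj₁ eq)
  ; (there (here eq))         → n≢next n (cong proj₁ eq)
  ; (there (there (here eq))) → n≢next² n (cong proj₁ eq) }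
  where
  rainbow≬X : ∀ n → ∃[ p ] pt n p ∈ ⟦ rainbow a (b , c) ⟧
  rainbow≬X 0F = a , here refl
  rainbow≬X 1F = b , there (here refl)
  rainbow≬X 2F = c , there (there (here refl))

-- The rainbows are separated by injectivity, the twelve skew sets by evaluation, and the two kinds
-- by whether they miss some Xₙ.
transversals-unique : SetoidUnique (finSetSetoid (Point 5 3)) transversals
transversals-unique = SetoidUnique.++⁺ ℙ
  (SetoidUnique.cartesianProductWith⁺ (setoid _) (setoid _) ℙ rainbow rainbow-injective
    (Unique.allFin⁺ 4) (Unique.cartesianProduct⁺ (Unique.allFin⁺ 4) (Unique.allFin⁺ 4)))
  (from-yes (Decide.unique? _≟ᴾ_ skews))
  λ {T} → disjoint {T}
  where
  ℙ = finSetSetoid (Point 5 3)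
  disjoint : ∀ {T} → ¬ (T ∈ ⟨ rainbows ⟩ × T ∈ ⟨ skews ⟩)
  disjoint {T} (T∈₁ , T∈₂) =
    let R , R∈ , T≈R = ∈⟨⟩⁻ {S = T} T∈₁ ; S , S∈ , T≈S = ∈⟨⟩⁻ {S = T} T∈₂
        a , b , c , R≡ = ∈-rainbows R∈  ; n , q , S≡   = ∈-skews S∈
    in rainbow≉skew a b c n q (subst₂ _≈_ R≡ S≡ (≈-trans R T S (≈-sym T R T≈R) T≈S))

transversals-block-𝔽 : ∀ T → T ∈ ⟨ transversals ⟩ → IsBlockingSet (𝔽 5 3) ⟦ T ⟧
transversals-block-𝔽 T T∈ B B∈ =
  ⟨⟩-blocks transversals≬blocks T T∈ B (proj₁ 𝔽≐blocks {B} B∈)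

-- Blocking sets of `𝔽 5 3` and of its transversals

module _ (S : FinSet (Point 5 3)) where

  Full : Fin 3 → Set
  Full n = ∀ q → pt n q ∈ ⟦ S ⟧

  meets? : ∀ n → Dec (∃[ q ] pt n q ∈ ⟦ S ⟧)
  meets? n = Fin.any? λ q → ∈? _≟ᴾ_ S (pt n q)

  full? : ∀ n → Dec (Full n)
  full? n = Fin.all? λ q → ∈? _≟ᴾ_ S (pt n q)

  meets-block : ∀ n r → ⟦ block n r ⟧ ≬ ⟦ S ⟧ →
                pt (next n) (r ↑ˡ 2) ∈ ⟦ S ⟧ ⊎ (∃[ q ] pt n q ∈ ⟦ S ⟧)
  meets-block n r (x , x∈B , x∈S) with ∈-block n r x∈B
  ... | inj₁ refl       = inj₁ x∈S
  ... | inj₂ (q , refl) = inj₂ (q , x∈S)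

  -- Both blocks of index n must be met outside Xₙ, in their extra points. The extra point of a
  -- block of index n + 2 lies in Xₙ, so that block must be met in Xₙ₊₂.
  contains-skew : IsBlockingSet (𝔽 5 3) ⟦ S ⟧ → ∀ n → ¬ (∃[ q ] pt n q ∈ ⟦ S ⟧) →
                  ∃[ q ] ⟦ skew n q ⟧ ⊆ ⟦ S ⟧
  contains-skew S-blocks n misses =
    let q , q∈ = meets-next² in q , λ
      { (here refl) → next∈ 0F ; (there (here refl)) → next∈ 1F ; (there (there (here refl))) → q∈ }
    where
    next∈ : ∀ r → pt (next n) (r ↑ˡ 2) ∈ ⟦ S ⟧
    next∈ r = [ (λ r∈ → r∈) , (λ meets → contradiction meets misses) ]′
      (meets-block n r (S-blocks (block n r) (block∈𝔽 n r)))
    meets-next² : ∃[ q ] pt (next (next n)) q ∈ ⟦ S ⟧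
    meets-next² =
      [ (λ r∈ → contradiction (0F , subst (λ m → pt m 0F ∈ ⟦ S ⟧) (next³ n) r∈) misses) , (λ meets → meets) ]′
      (meets-block _ 0F (S-blocks (block (next (next n)) 0F) (block∈𝔽 (next (next n)) 0F)))

  contains-transversal : IsBlockingSet (𝔽 5 3) ⟦ S ⟧ → ∃[ T ] T ∈ ⟨ transversals ⟩ × ⟦ T ⟧ ⊆ ⟦ S ⟧
  contains-transversal S-blocks with Fin.all? meets?
  ... | yes meets = rainbow (f 0F) (f 1F , f 2F) , rainbow∈ (f 0F) (f 1F) (f 2F) , λ
    { (here refl) → f∈ 0F ; (there (here refl)) → f∈ 1F ; (there (there (here refl))) → f∈ 2F }
    where
    f  = λ n → proj₁ (meets n)
    f∈ = λ n → proj₂ (meets n)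
  ... | no ¬meets =
    let n , misses = Fin.¬∀⟶∃¬ 3 _ meets? ¬meets
        q , ⊆S     = contains-skew S-blocks n misses
    in skew n q , skew∈ n q , ⊆S

  -- If S contains Xₙ but neither of xⁿ⁺¹₀, xⁿ⁺¹₁, then the transversals skew n q
  -- force it to contain all of Xₙ₊₂, hence a block with index n + 2.
  contains-block : IsBlockingSet ⟨ transversals ⟩ ⟦ S ⟧ → ∃[ B ] B ∈ 𝔽 5 3 × ⟦ B ⟧ ⊆ ⟦ S ⟧
  contains-block S-blocks with Fin.any? full?
  ... | no ¬full =
    case S-blocks (rainbow (f 0F) (f 1F , f 2F)) (rainbow∈ (f 0F) (f 1F) (f 2F)) of λ
      { (_ , here refl , x∈S) → contradiction x∈S (f∉ 0F)
      ; (_ , there (here refl) , x∈S) → contradiction x∈S (f∉ 1F)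
      ; (_ , there (there (here refl)) , x∈S) → contradiction x∈S (f∉ 2F) }
    where
    missing = λ n → Fin.¬∀⟶∃¬ 4 _ (λ q → ∈? _≟ᴾ_ S (pt n q)) (λ full → ¬full (n , full))
    f  = λ n → proj₁ (missing n)
    f∉ = λ n → proj₂ (missing n)
  ... | yes (n , full) with Fin.any? (λ r → ∈? _≟ᴾ_ S (pt (next n) (r ↑ˡ 2)))
  ...   | yes (r , r∈) = block n r , block∈𝔽 n r , block-⊆ n r S r∈ full
  ...   | no ¬r∈ = block (next (next n)) 0F , block∈𝔽 _ 0F ,
    -- By `next³` the extra point of this block lies in Xₙ, all of which is in `S`.
    block-⊆ (next (next n)) 0F S (subst (λ m → pt m 0F ∈ ⟦ S ⟧) (sym (next³ n)) (full 0F)) λ q →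
      case S-blocks (skew n q) (skew∈ n q) of λ
        { (_ , here refl , x∈S) → contradiction (0F , x∈S) ¬r∈
        ; (_ , there (here refl) , x∈S) → contradiction (1F , x∈S) ¬r∈
        ; (_ , there (there (here refl)) , x∈S) → x∈S }

transversal-minimal : ∀ S → IsBlockingSet (𝔽 5 3) ⟦ S ⟧ →
                      3 ≤ size S × (size S ≡ 3 → S ∈ ⟨ transversals ⟩)
transversal-minimal S S-blocks =
  contains⇒minimal _≟ᴾ_ (λ {S} {T} → ⟨⟩-respects {x = S} {T}) transversals-uniform S
    (contains-transversal S S-blocks)

transversals-nonempty : ∃[ T ] T ∈ ⟨ transversals ⟩
transversals-nonempty = rainbow 0F (0F , 0F) , rainbow∈ 0F 0F 0F

tr-𝔽 : IsTr (𝔽 5 3) 3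
tr-𝔽 = IsTr-intro transversals-nonempty transversals-uniform transversals-block-𝔽 transversal-minimal

transversals≐𝔽⊤ : ⟨ transversals ⟩ ≐ 𝔽 5 3 ^⊤
transversals≐𝔽⊤ =
  ≐⊤-intro transversals-nonempty transversals-uniform transversals-block-𝔽 transversal-minimal

-- The CIF(5,3) property and the MIF(5) with 234 blocks

𝔽-uniform : IsUniform (𝔽 5 3) 5
𝔽-uniform B B∈ = proj₁ B∈

𝔽-respects : 𝔽 5 3 Respects _≈_
𝔽-respects {B} {C} B≈C B∈ =
  proj₂ 𝔽≐blocks {C} (⟨⟩-respects {x = B} {C} B≈C (proj₁ 𝔽≐blocks {B} B∈))

-- Evaluated on all pairs of the six listed blocks.
𝔽-intersecting : ∀ B → B ∈ 𝔽 5 3 → IsBlockingSet (𝔽 5 3) ⟦ B ⟧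
𝔽-intersecting B B∈ C C∈ = ⟨⟩-blocks (from-yes (Decide.pairwise-≬? _≟ᴾ_ blocks blocks))
  B (proj₁ 𝔽≐blocks {B} B∈) C (proj₁ 𝔽≐blocks {C} C∈)

𝔽-isCIF : IsCIF 5 3 (𝔽 5 3)
𝔽-isCIF = record
  { isFamily = record
    { respects       = λ {B} {C} → 𝔽-respects {B} {C}
    ; nonempty       = nonempty
    ; blocksNonempty = λ B B∈ → let x , x∈ , _ = 𝔽-intersecting B B∈ B B∈ in x , x∈
    }
  ; uniform  = 𝔽-uniform
  ; tr       = tr-𝔽
  ; t≤k-1    = s≤s (s≤s (s≤s z≤n))
  -- Blocks have size 5 and transversals size 3.
  ; disjoint = λ {B} (B∈𝔽 , B∈⊤) → case trans (sym (𝔽-uniform B B∈𝔽)) (size-⊤ tr-𝔽 B B∈⊤) of λ ()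
  -- Blocks meet blocks by `𝔽-intersecting` and meet transversals by definition. Conversely,
  -- blocking the transversals alone already forces a block inside `S`.
  ; closed   = ≐⊤-intro nonempty 𝔽-uniform
      (λ B B∈ C → [ 𝔽-intersecting B B∈ C , (λ C∈⊤ → ≬-sym (proj₁ C∈⊤ B B∈)) ]′)
      (λ S S-blocks → contains⇒minimal _≟ᴾ_ (λ {B} {C} → 𝔽-respects {B} {C}) 𝔽-uniform S
        (contains-block S λ T T∈ → S-blocks T (inj₂ (proj₁ transversals≐𝔽⊤ {T} T∈))))
  }
  where
  nonempty : ∃[ B ] B ∈ 𝔽 5 3
  nonempty = block 0F 0F , block∈𝔽 0F 0F

𝔽-cardinality : HasCardinality (𝔽 5 3) 6
𝔽-cardinality = ⟨⟩-cardinality 𝔽≐blocks (from-yes (Decide.unique? _≟ᴾ_ blocks))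

𝔽⊤-cardinality : HasCardinality (𝔽 5 3 ^⊤) 76
𝔽⊤-cardinality =
  ⟨⟩-cardinality (≐-sym transversals≐𝔽⊤) transversals-unique

𝔽⋈pairs-isMIF : IsMIF 5 (𝔽 5 3 ⋈ ⟨ pairs ⟩)
𝔽⋈pairs-isMIF = CIF⋈MIF.⋈-isMIF 𝔽-isCIF pairs-isMIF refl (blocks-or-misses Fin._≟_ pairs-cardinality)

𝔽⋈pairs-cardinality : HasCardinality (𝔽 5 3 ⋈ ⟨ pairs ⟩) 234
𝔽⋈pairs-cardinality = ⋈-cardinality (IsFamily.blocksNonempty (IsMIF.isFamily pairs-isMIF))
  𝔽-cardinality 𝔽⊤-cardinality pairs-cardinality

mainTheorem5 : IsCIF 5 3 (𝔽 5 3)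
    × HasCardinality (𝔽 5 3) 6
    × HasCardinality (𝔽 5 3 ^⊤) 76
    × (Σ[ A ∈ Set ] Σ[ 𝓕 ∈ Collection A ] ∃[ n ] IsMIF 5 𝓕 × HasCardinality 𝓕 n × 234 ≤ n)
    × (∀ m → IsM 5 m → 234 ≤ m)
mainTheorem5 =
  𝔽-isCIF , 𝔽-cardinality , 𝔽⊤-cardinality ,
  (_ , _ , 234 , 𝔽⋈pairs-isMIF , 𝔽⋈pairs-cardinality , ≤-refl) ,
  λ m isM → IsM.maximal isM _ _ 234 𝔽⋈pairs-isMIF 𝔽⋈pairs-cardinality
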